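{- A maximum $5\times 5$ board configuration contains fifteen prisoners; that is, $P(5)=15$.
   Context: A configuration on an $n\times n$ board assigns to each of the $n^2$ squares exactly one occupant, either a prisoner or a guard. Two distinct squares are adjacent if one is directly above, below, to the left, to the right, or diagonal to the other (king-move adjacency). A configuration is valid (a valid board) if every square occupied by a prisoner is adjacent to at least as many squares occupied by guards as squares occupied by (other) prisoners. A maximum configuration (maximum board) is a valid board that has the greatest number of prisoners among all valid boards on the $n\times n$ board. $P(n)$ denotes the number of prisoners in a maximum configuration on the $n\times n$ board. -}

module Defs where

open import Data.Fin.Base using (Fin; toℕ)
import Data.Fin.Properties as Fin
open import Data.List.Base
  using (List; []; _∷_; [_]; length; filter; allFin; cartesianProduct; cartesianProductWith)
import Data.List.Extrema as Extrema
open import Data.List.Membership.Propositional using (_∈_)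
open import Data.List.Membership.Propositional.Properties
  using (∈-cartesianProductWith⁺; ∈-filter⁺)
open import Data.List.Relation.Unary.Any using (here; there)
import Data.List.Relation.Unary.All as All
open import Data.List.Relation.Unary.All.Properties using (all-filter)
open import Data.Nat.Base using (ℕ; zero; suc; _≤_; ∣_-_∣)
import Data.Nat.Properties as ℕ
open import Data.Product.Base using (_×_; _,_; Σ-syntax; proj₁; proj₂)
open import Data.Product.Properties using (≡-dec)
open import Data.Vec.Base using (Vec; []; _∷_; lookup; replicate)
open import Data.Vec.Properties using (lookup-replicate)
open import Relation.Binary.Definitions using (DecidableEquality; Decidable)
open import Relation.Binary.PropositionalEquality.Core using (_≡_; _≢_; refl; sym; trans; cong)
open import Relation.Nullary.Decidable using (Dec; yes; no; map′; ¬?; _×-dec_; _→-dec_)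
open import Relation.Nullary.Negation.Core using (contradiction)

private
  variable
    n : ℕ

data Occupant : Set where
  prisoner guard : Occupant

_≟ᵒ_ : DecidableEquality Occupant
prisoner ≟ᵒ prisoner = yes refl
prisoner ≟ᵒ guard    = no λ ()
guard    ≟ᵒ prisoner = no λ ()
guard    ≟ᵒ guard    = yes refl

Square : ℕ → Set
Square n = Fin n × Fin n

squares : ∀ n → List (Square n)
squares n = cartesianProduct (allFin n) (allFin n)

_≟ˢ_ : DecidableEquality (Square n)
_≟ˢ_ = ≡-dec Fin._≟_ Fin._≟_

-- King moves: distinct squares whose rows and columns each differ by at most one.
Adjacent : Square n → Square n → Set
Adjacent s@(i , j) t@(k , l) =
  s ≢ t × ∣ toℕ i - toℕ k ∣ ≤ 1 × ∣ toℕ j - toℕ l ∣ ≤ 1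

adjacent? : Decidable (Adjacent {n})
adjacent? s@(i , j) t@(k , l) =
  ¬? (s ≟ˢ t) ×-dec (∣ toℕ i - toℕ k ∣ ℕ.≤? 1) ×-dec (∣ toℕ j - toℕ l ∣ ℕ.≤? 1)

Configuration : ℕ → Set
Configuration n = Vec (Vec Occupant n) n

occupant : Configuration n → Square n → Occupant
occupant c (i , j) = lookup (lookup c i) j

adjacentCount : Configuration n → Occupant → Square n → ℕ
adjacentCount {n} c o s =
  length (filter (λ t → adjacent? s t ×-dec (occupant c t ≟ᵒ o)) (squares n))

prisoners : Configuration n → ℕ
prisoners {n} c = length (filter (λ s → occupant c s ≟ᵒ prisoner) (squares n))

Valid : Configuration n → Set
Valid {n} c = (s : Square n) → occupant c s ≡ prisoner →
              adjacentCount c prisoner s ≤ adjacentCount c guard s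

Maximum : Configuration n → Set
Maximum {n} c = Valid c × ((d : Configuration n) → Valid d → prisoners d ≤ prisoners c)

valid? : (c : Configuration n) → Dec (Valid c)
valid? c = map′ (λ f (i , j) → f i j) (λ f i j → f (i , j))
  (Fin.all? λ i → Fin.all? λ j →
    (occupant c (i , j) ≟ᵒ prisoner) →-dec
    (adjacentCount c prisoner (i , j) ℕ.≤? adjacentCount c guard (i , j)))

allVecs : {A : Set} → List A → ∀ n → List (Vec A n)
allVecs xs zero    = [ [] ]
allVecs xs (suc n) = cartesianProductWith _∷_ xs (allVecs xs n)

∈-allVecs : {A : Set} {xs : List A} → (∀ x → x ∈ xs) → (v : Vec A n) → v ∈ allVecs xs n
∈-allVecs all []      = here refl
∈-allVecs all (x ∷ v) = ∈-cartesianProductWith⁺ _∷_ (all x) (∈-allVecs all v)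

occupants : List Occupant
occupants = prisoner ∷ guard ∷ []

∈-occupants : ∀ o → o ∈ occupants
∈-occupants prisoner = here refl
∈-occupants guard    = there (here refl)

configurations : ∀ n → List (Configuration n)
configurations n = allVecs (allVecs occupants n) n

∈-configurations : (c : Configuration n) → c ∈ configurations n
∈-configurations = ∈-allVecs (∈-allVecs ∈-occupants)

allGuards : ∀ n → Configuration n
allGuards n = replicate n (replicate n guard)

allGuards-valid : ∀ n → Valid (allGuards n)
allGuards-valid n (i , j) eq = contradiction (trans (sym eq) isGuard) λ ()
  where
  isGuard : occupant (allGuards n) (i , j) ≡ guard
  isGuard = trans (cong (λ r → lookup r j) (lookup-replicate i (replicate n guard)))
                  (lookup-replicate j guard)

-- Abstract because the search runs through all 2^(n²) configurations and
-- should never be evaluated; its type is all that is needed.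
abstract
  maximum : ∀ n → Σ[ c ∈ Configuration n ] Maximum c
  maximum n = best , argmax-all prisoners (allGuards-valid n) (all-filter valid? (configurations n))
            , λ d d-valid → All.lookup (f[xs]≤f[argmax] (allGuards n) valids)
                                       (∈-filter⁺ valid? (∈-configurations d) d-valid)
    where
    open Extrema ℕ.≤-totalOrder using (argmax; argmax-all; f[xs]≤f[argmax])
    valids : List (Configuration n)
    valids = filter valid? (configurations n)
    best : Configuration n
    best = argmax prisoners (allGuards n) valids

-- Independent of the choice of maximum configuration, as any two of them
-- have the same number of prisoners.
P : ℕ → ℕ
P n = prisoners (proj₁ (maximum n))

{-# OPTIONS --safe #-}
-- Weight the squares of a 3×3 corner of the board by 2, 2, 1 (outside to
-- centre) in each direction, multiplied. The corner contains all neighbours of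
-- its outermost 2×2 block, and validity on that block alone forces the
-- prisoners of the corner to have weight at most 15 out of 25. The four corners
-- overlap in the middle row and column, so that every square of the 5×5 board
-- gets total weight 4; hence four times the number of prisoners is at most 60.
-- Alternating columns of prisoners and guards attain 15.
module Submission where

open import Defs
open import Data.Bool.Base using (true; false)
open import Data.Fin.Base using (Fin; zero; suc; inject₁; _↑ˡ_; _↑ʳ_)
import Data.Fin.Properties as Fin
open import Data.List.Base
  using (List; []; _∷_; _++_; length; filter; map; allFin; cartesianProduct)
open import Data.List.Properties using (≡-dec; filter-++; length-++; map-∘; map-cong)
open import Data.List.Relation.Unary.All as All using (All)
open import Data.Nat.Base using (ℕ; _≤_; _+_; _*_)
open import Data.Nat.ListAction using (sum)
import Data.Nat.Properties as ℕ
open import Data.Nat.Tactic.RingSolver using (solve-∀)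
open import Data.Product.Base using (_×_; _,_; proj₁; proj₂)
open import Data.Vec.Base using (tabulate; lookup; replicate; []; _∷_)
open import Data.Vec.Properties using (lookup∘tabulate)
open import Function.Base using (_∘_)
open import Level using (Level)
open import Relation.Binary.PropositionalEquality
  using (_≡_; refl; sym; trans; cong; cong₂; subst₂; module ≡-Reasoning)
open import Relation.Nullary.Decidable
  using (Dec; does; from-yes; _×-dec_; _→-dec_)
open import Relation.Unary using (Pred; Decidable)

private
  variable
    a p : Level
    A B : Set a
    n : ℕ

-- Prisoner counts as double sums.

∑ : ∀ n → (Fin n → ℕ) → ℕ
∑ n f = sum (map f (allFin n))

∑-cong : ∀ n {f g : Fin n → ℕ} → (∀ i → f i ≡ g i) → ∑ n f ≡ ∑ n g
∑-cong n f≗g = cong sum (map-cong f≗g (allFin n))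

isPrisoner : Occupant → ℕ
isPrisoner prisoner = 1
isPrisoner guard    = 0

length-filter-≟prisoner : (f : A → Occupant) (xs : List A) →
  length (filter (λ x → f x ≟ᵒ prisoner) xs) ≡ sum (map (isPrisoner ∘ f) xs)
length-filter-≟prisoner f []       = refl
length-filter-≟prisoner f (x ∷ xs) with f x
... | prisoner = cong (1 +_) (length-filter-≟prisoner f xs)
... | guard    = length-filter-≟prisoner f xs

length-filter-cartesianProduct : {P : Pred (A × B) p} (P? : Decidable P) →
  ∀ xs ys → length (filter P? (cartesianProduct xs ys)) ≡
            sum (map (λ x → length (filter P? (map (x ,_) ys))) xs)
length-filter-cartesianProduct P? []       ys = refl
length-filter-cartesianProduct P? (x ∷ xs) ys = begin
  length (filter P? (map (x ,_) ys ++ cartesianProduct xs ys))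
    ≡⟨ cong length (filter-++ P? (map (x ,_) ys) _) ⟩
  length (filter P? (map (x ,_) ys) ++ filter P? (cartesianProduct xs ys))
    ≡⟨ length-++ (filter P? (map (x ,_) ys)) ⟩
  length (filter P? (map (x ,_) ys)) + length (filter P? (cartesianProduct xs ys))
    ≡⟨ cong (length (filter P? (map (x ,_) ys)) +_) (length-filter-cartesianProduct P? xs ys) ⟩
  length (filter P? (map (x ,_) ys)) + sum (map (λ z → length (filter P? (map (z ,_) ys))) xs) ∎
  where open ≡-Reasoning

-- An iterated sum lets rows and columns be weighted separately.
prisoners≡∑∑ : (c : Configuration n) →
  prisoners c ≡ ∑ n (λ i → ∑ n (λ j → isPrisoner (occupant c (i , j))))
prisoners≡∑∑ {n} c = trans
  (length-filter-cartesianProduct (λ s → occupant c s ≟ᵒ prisoner) (allFin n) (allFin n))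
  (∑-cong n λ i → trans (length-filter-≟prisoner (occupant c) (map (i ,_) (allFin n)))
                        (cong sum (sym (map-∘ (allFin n)))))

-- Adjacency counts from neighbour lists.

neighbours : Square n → List (Square n)
neighbours s = filter (adjacent? s) (squares _)

length-filter-×-≟ : {P : Pred A p} (P? : Decidable P) (f : A → Occupant) (o : Occupant) →
  ∀ xs → length (filter (λ x → P? x ×-dec (f x ≟ᵒ o)) xs) ≡
         length (filter (_≟ᵒ o) (map f (filter P? xs)))
length-filter-×-≟ P? f o []       = refl
length-filter-×-≟ P? f o (x ∷ xs) with does (P? x)
... | false = length-filter-×-≟ P? f o xs
... | true with does (f x ≟ᵒ o)
...   | false = length-filter-×-≟ P? f o xs
...   | true  = cong (1 +_) (length-filter-×-≟ P? f o xs)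

-- `neighbours s` does not depend on `c`, so counts on two boards can be compared by comparing
-- closed lists of squares.
adjacentCount≡ : (c : Configuration n) (o : Occupant) (s : Square n) →
  adjacentCount c o s ≡ length (filter (_≟ᵒ o) (map (occupant c) (neighbours s)))
adjacentCount≡ c o s = length-filter-×-≟ (adjacent? s) (occupant c) o (squares _)

-- The four corners and their embedding in the board.

data End : Set where
  low high : End

at : End → Fin 3 → Fin 5
at low  i = i ↑ˡ 2
at high i = 2 ↑ʳ i

-- The two indices away from the middle line of the board, which is index 2 for `low` and index 0
-- for `high`.
outer : End → Fin 2 → Fin 3
outer low  = inject₁
outer high = suc

-- The middle line lies in both ranges of `at` and gets 1 from each; every other line lies in one
-- range and gets 2.
weight : End → Fin 3 → ℕ
weight low  (suc (suc zero)) = 1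
weight high zero             = 1
weight _    _                = 2

place : End → End → Square 3 → Square 5
place e f (i , j) = at e i , at f j

corner : End → End → Configuration 5 → Configuration 3
corner e f c = tabulate λ i → tabulate λ j → occupant c (place e f (i , j))

occupant-corner : ∀ e f c s → occupant (corner e f c) s ≡ occupant c (place e f s)
occupant-corner e f c (i , j) =
  trans (cong (λ r → lookup r j) (lookup∘tabulate (λ k → tabulate (entry k)) i))
        (lookup∘tabulate (entry i) j)
  where
  entry : Fin 3 → Fin 3 → Occupant
  entry k l = occupant c (place e f (k , l))

-- A king move from an outer square stays inside the corner. The lists agree even in order, since
-- `place e f` is increasing in both coordinates.
neighbours-outer : ∀ e f i j → let s = outer e i , outer f j in
  map (place e f) (neighbours s) ≡ neighbours (place e f s)
-- With both ends fixed the check is a closed computation.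
neighbours-outer = λ where
    low  low  → from-yes (check low  low)
    low  high → from-yes (check low  high)
    high low  → from-yes (check high low)
    high high → from-yes (check high high)
  where
  check : ∀ e f → Dec (∀ i j → let s = outer e i , outer f j in
                       map (place e f) (neighbours s) ≡ neighbours (place e f s))
  check e f = Fin.all? λ i → Fin.all? λ j → ≡-dec _≟ˢ_ _ _

adjacentCount-corner : ∀ e f c o i j → let s = outer e i , outer f j in
  adjacentCount c o (place e f s) ≡ adjacentCount (corner e f c) o s
adjacentCount-corner e f c o i j = begin
  adjacentCount c o (place e f s)
    ≡⟨ adjacentCount≡ c o (place e f s) ⟩
  count (map (occupant c) (neighbours (place e f s)))
    ≡⟨ cong (count ∘ map (occupant c)) (neighbours-outer e f i j) ⟨
  count (map (occupant c) (map (place e f) (neighbours s)))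
    ≡⟨ cong count (map-∘ (neighbours s)) ⟨
  count (map (occupant c ∘ place e f) (neighbours s))
    ≡⟨ cong count (map-cong (occupant-corner e f c) (neighbours s)) ⟨
  count (map (occupant (corner e f c)) (neighbours s))
    ≡⟨ adjacentCount≡ (corner e f c) o s ⟨
  adjacentCount (corner e f c) o s ∎
  where
  open ≡-Reasoning
  s : Square 3
  s = outer e i , outer f j
  count : List Occupant → ℕ
  count = length ∘ filter (_≟ᵒ o)

-- Validity on the outer block and the weight bound.

ValidAt : Configuration n → Square n → Set
ValidAt c s = occupant c s ≡ prisoner → adjacentCount c prisoner s ≤ adjacentCount c guard s

validAt? : (c : Configuration n) (s : Square n) → Dec (ValidAt c s)
validAt? c s =
  (occupant c s ≟ᵒ prisoner) →-dec (adjacentCount c prisoner s ℕ.≤? adjacentCount c guard s)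

-- The remaining squares of a corner have neighbours beyond it, so a valid board need not restrict
-- to a valid 3×3 configuration.
OuterValid : End → End → Configuration 3 → Set
OuterValid e f q = ∀ i j → ValidAt q (outer e i , outer f j)

outerValid? : ∀ e f q → Dec (OuterValid e f q)
outerValid? e f q = Fin.all? λ i → Fin.all? λ j → validAt? q (outer e i , outer f j)

corner-valid : ∀ e f c → Valid c → OuterValid e f (corner e f c)
corner-valid e f c valid i j isP = subst₂ _≤_
  (adjacentCount-corner e f c prisoner i j) (adjacentCount-corner e f c guard i j)
  (valid (place e f s) (trans (sym (occupant-corner e f c s)) isP))
  where
  s : Square 3
  s = outer e i , outer f j

weigh : End → (Fin 3 → ℕ) → ℕ
weigh e f = ∑ 3 λ i → weight e i * f i

weigh-cong : ∀ e {f g : Fin 3 → ℕ} → (∀ i → f i ≡ g i) → weigh e f ≡ weigh e g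
weigh-cong e f≗g = ∑-cong 3 λ i → cong (weight e i *_) (f≗g i)

cornerWeight : End → End → Configuration 3 → ℕ
cornerWeight e f q = weigh e λ i → weigh f λ j → isPrisoner (occupant q (i , j))

-- Exhaustive check of the 512 configurations for each corner. The bound is sharp: every corner of
-- `alternatingColumns` has weight 5 * 3.
outerValid⇒cornerWeight≤15 : ∀ e f q → OuterValid e f q → cornerWeight e f q ≤ 15
outerValid⇒cornerWeight≤15 e f q = All.lookup (all e f) (∈-configurations q)
  where
  Bounded : End → End → Configuration 3 → Set
  Bounded e f q = OuterValid e f q → cornerWeight e f q ≤ 15
  bounded? : ∀ e f → Dec (All (Bounded e f) (configurations 3))
  bounded? e f = All.all? (λ q → outerValid? e f q →-dec (cornerWeight e f q ℕ.≤? 15)) (configurations 3)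
  all : ∀ e f → All (Bounded e f) (configurations 3)
  all low  low  = from-yes (bounded? low  low)
  all low  high = from-yes (bounded? low  high)
  all high low  = from-yes (bounded? high low)
  all high high = from-yes (bounded? high high)

-- Adding up the corner weights.

weigh-+ : ∀ e (f g : Fin 3 → ℕ) → weigh e f + weigh e g ≡ weigh e (λ i → f i + g i)
-- The weights enter as variables, which avoids a case split on `e`; each `+ 0` is the sum of the
-- empty list.
weigh-+ e f g = identity (weight e zero) (weight e (suc zero)) (weight e (suc (suc zero)))
                         (f zero) (f (suc zero)) (f (suc (suc zero)))
                         (g zero) (g (suc zero)) (g (suc (suc zero)))
  where
  identity : ∀ a b c u v w x y z →
    (a * u + (b * v + (c * w + 0))) + (a * x + (b * y + (c * z + 0))) ≡
    a * (u + x) + (b * (v + y) + (c * (w + z) + 0))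
  identity = solve-∀

weigh-low+high : (f : Fin 5 → ℕ) →
  weigh low (f ∘ at low) + weigh high (f ∘ at high) ≡ 2 * ∑ 5 f
weigh-low+high f = identity (f zero) (f (suc zero)) (f (suc (suc zero)))
                            (f (suc (suc (suc zero)))) (f (suc (suc (suc (suc zero)))))
  where
  identity : ∀ u v w x y →
    (2 * u + (2 * v + (1 * w + 0))) + (1 * w + (2 * x + (2 * y + 0))) ≡
    2 * (u + (v + (w + (x + (y + 0)))))
  identity = solve-∀

∑-*ˡ : ∀ (k : ℕ) (f : Fin 5 → ℕ) → ∑ 5 (λ i → k * f i) ≡ k * ∑ 5 f
∑-*ˡ k f = identity k (f zero) (f (suc zero)) (f (suc (suc zero)))
                    (f (suc (suc (suc zero)))) (f (suc (suc (suc (suc zero)))))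
  where
  identity : ∀ k u v w x y →
    k * u + (k * v + (k * w + (k * x + (k * y + 0)))) ≡ k * (u + (v + (w + (x + (y + 0)))))
  identity = solve-∀

-- Joining the two column ends gives twice each row sum (`rows`); joining the two row ends doubles
-- again.
cornerWeights≡4*prisoners : ∀ c → let w = λ e f → cornerWeight e f (corner e f c) in
  (w low low + w low high) + (w high low + w high high) ≡ 4 * prisoners c
cornerWeights≡4*prisoners c = begin
  (w low low + w low high) + (w high low + w high high)
    ≡⟨ cong₂ _+_ (rows low) (rows high) ⟩
  weigh low ((λ i → 2 * rowSum i) ∘ at low) + weigh high ((λ i → 2 * rowSum i) ∘ at high)
    ≡⟨ weigh-low+high (λ i → 2 * rowSum i) ⟩
  2 * ∑ 5 (λ i → 2 * rowSum i)
    ≡⟨ cong (2 *_) (∑-*ˡ 2 rowSum) ⟩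
  2 * (2 * ∑ 5 rowSum)
    ≡⟨ ℕ.*-assoc 2 2 (∑ 5 rowSum) ⟨
  4 * ∑ 5 rowSum
    ≡⟨ cong (4 *_) (prisoners≡∑∑ c) ⟨
  4 * prisoners c ∎
  where
  open ≡-Reasoning
  w : End → End → ℕ
  w e f = cornerWeight e f (corner e f c)
  entry : Fin 5 → Fin 5 → ℕ
  entry i j = isPrisoner (occupant c (i , j))
  rowSum : Fin 5 → ℕ
  rowSum i = ∑ 5 (entry i)
  w≡ : ∀ e f → w e f ≡ weigh e (λ i → weigh f (entry (at e i) ∘ at f))
  w≡ e f = weigh-cong e λ i → weigh-cong f λ j → cong isPrisoner (occupant-corner e f c (i , j))
  rows : ∀ e → w e low + w e high ≡ weigh e ((λ i → 2 * rowSum i) ∘ at e)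
  rows e = trans (cong₂ _+_ (w≡ e low) (w≡ e high))
          (trans (weigh-+ e (λ i → weigh low  (entry (at e i) ∘ at low))
                            (λ i → weigh high (entry (at e i) ∘ at high)))
          (weigh-cong e λ i → weigh-low+high (entry (at e i))))

-- The upper bound and a board attaining it.

valid⇒prisoners≤15 : (c : Configuration 5) → Valid c → prisoners c ≤ 15
valid⇒prisoners≤15 c valid = ℕ.*-cancelˡ-≤ 4
  (ℕ.≤-trans (ℕ.≤-reflexive (sym (cornerWeights≡4*prisoners c)))
             (ℕ.+-mono-≤ (ℕ.+-mono-≤ (bound low low) (bound low high))
                         (ℕ.+-mono-≤ (bound high low) (bound high high))))
  where
  bound : ∀ e f → cornerWeight e f (corner e f c) ≤ 15
  bound e f = outerValid⇒cornerWeight≤15 e f (corner e f c) (corner-valid e f c valid)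

alternatingColumns : Configuration 5
alternatingColumns = replicate 5 (prisoner ∷ guard ∷ prisoner ∷ guard ∷ prisoner ∷ [])

alternatingColumns-valid : Valid alternatingColumns
alternatingColumns-valid = from-yes (valid? alternatingColumns)

maximum⇒prisoners≡15 : (c : Configuration 5) → Maximum c → prisoners c ≡ 15
maximum⇒prisoners≡15 c (valid , greatest) =
  -- `prisoners alternatingColumns` evaluates to 15: three full columns of five.
  ℕ.≤-antisym (valid⇒prisoners≤15 c valid) (greatest alternatingColumns alternatingColumns-valid)

proposition3p2 : ((c : Configuration 5) → Maximum c → prisoners c ≡ 15) × P 5 ≡ 15
-- `P 5` is never computed: the maximality proof carried by `maximum 5` suffices.
proposition3p2 = maximum⇒prisoners≡15 , maximum⇒prisoners≡15 (proj₁ (maximum 5)) (proj₂ (maximum 5))
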